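{- Let $k\in\mathbb{N}$ and let $G$ be a graph with (edge) arboricity $2$. If $k\ge\lceil(\Delta(G)+1)/2\rceil$, then $G$ is equitably $k$-list arborable.
   Context: Graphs are finite and simple. The (edge) arboricity of $G$ is the minimum number of forests into which $E(G)$ can be partitioned. $\Delta(G)$ is the maximum degree. A $k$-uniform list assignment $L$ for $G$ assigns to each vertex $v$ a set $L(v)$ of exactly $k$ colours; an $L$-colouring is a map $c$ with $c(v)\in L(v)$; it is equitable if every colour class has at most $\lceil |V(G)|/k\rceil$ vertices. $G$ is equitably $k$-list arborable if for every $k$-uniform list assignment $L$ there is an equitable $L$-colouring of $G$ in which every colour class induces an acyclic subgraph. -}

module Defs where

open import Data.Bool using (Bool; true; false; T)
open import Data.Nat using (ℕ; zero; suc; _+_; _≤_; _⊔_; _≡ᵇ_; ⌈_/2⌉; _/_)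
open import Data.Fin using (Fin; inject₁; fromℕ) renaming (zero to fzero; suc to fsuc)
open import Data.List using (List; length; filterᵇ; allFin; map; foldr)
open import Data.Product using (Σ; _×_; ∃)
open import Function.Definitions using (Injective)
open import Relation.Binary.PropositionalEquality using (_≡_)
open import Relation.Nullary using (¬_)

record Graph (n : ℕ) : Set where
  field
    adj     : Fin n → Fin n → Bool
    symm    : ∀ u v → adj u v ≡ adj v u
    irrefl  : ∀ v → adj v v ≡ false
open Graph public

Adj : ∀ {n} → Graph n → Fin n → Fin n → Set
Adj G u v = T (adj G u v)

HasCycle : ∀ {n} → (Fin n → Fin n → Set) → Set
HasCycle {n} E =
  Σ ℕ λ m → Σ (Fin (suc (suc (suc m))) → Fin n) λ f →
    Injective _≡_ _≡_ f
    × (∀ (i : Fin (suc (suc m))) → E (f (inject₁ i)) (f (fsuc i)))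
    × E (f (fromℕ (suc (suc m)))) (f fzero)

Acyclic : ∀ {n} → (Fin n → Fin n → Set) → Set
Acyclic E = ¬ HasCycle E

ForestDecomposition : ∀ {n} → Graph n → ℕ → Set
ForestDecomposition {n} G t =
  Σ (Fin n → Fin n → Fin t) λ c →
    (∀ u v → Adj G u v → c u v ≡ c v u)
    × (∀ (j : Fin t) → Acyclic (λ u v → Adj G u v × c u v ≡ j))

HasArboricity : ∀ {n} → Graph n → ℕ → Set
HasArboricity G a =
  ForestDecomposition G a × (∀ t → ForestDecomposition G t → a ≤ t)

degree : ∀ {n} → Graph n → Fin n → ℕ
degree {n} G v = length (filterᵇ (adj G v) (allFin n))

maxDegree : ∀ {n} → Graph n → ℕ
maxDegree {n} G = foldr _⊔_ 0 (map (degree G) (allFin n))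

-- ⌈ n / k ⌉ (k ≥ 1; the value for k = 0 is irrelevant)
ceilDiv : ℕ → ℕ → ℕ
ceilDiv n zero    = 0
ceilDiv n (suc k) = (n + k) / suc k

ListAssignment : ℕ → ℕ → Set
ListAssignment n k = Fin n → Fin k → ℕ

Uniform : ∀ {n k} → ListAssignment n k → Set
Uniform L = ∀ v → Injective _≡_ _≡_ (L v)

IsLColouring : ∀ {n k} → ListAssignment n k → (Fin n → ℕ) → Set
IsLColouring L c = ∀ v → ∃ λ i → L v i ≡ c v

colourClassSize : ∀ {n} → (Fin n → ℕ) → ℕ → ℕ
colourClassSize {n} c x = length (filterᵇ (λ v → c v ≡ᵇ x) (allFin n))

Equitable : ∀ {n} → ℕ → (Fin n → ℕ) → Set
Equitable {n} k c = ∀ x → colourClassSize c x ≤ ceilDiv n k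

ClassesAcyclic : ∀ {n} → Graph n → (Fin n → ℕ) → Set
ClassesAcyclic G c = ∀ x → Acyclic (λ u v → Adj G u v × c u ≡ x × c v ≡ x)

EquitablyListArborable : ∀ {n} → Graph n → ℕ → Set
EquitablyListArborable {n} G k =
  ∀ (L : ListAssignment n k) → Uniform L →
    ∃ λ c → IsLColouring L c × Equitable k c × ClassesAcyclic G c

{-# OPTIONS --safe #-}

-- Write G as the union of two forests A and B, and move edges from A to B until
-- every non-isolated vertex has an edge in B: a vertex v without one sends any of
-- its edges over, and v is then a leaf of B, so B stays a forest.  The degrees in
-- A are now at most Δ(G) − 1 ≤ 2k − 2, and a forest with such degrees has an
-- equitable proper colouring from any lists of size k (Kostochka, Pelsmajer and
-- West).  Its colour classes contain no edge of A, so they induce subgraphs of B.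
--
-- The colouring is built by induction, removing k vertices y₁, …, y_k such that
-- y_i has less than i neighbours outside the set, and giving them distinct colours
-- in the order y_k, …, y₁.  Take a vertex u with a leaf w as a neighbour and at
-- most one neighbour that is not a leaf.  If u has k − 1 leaf neighbours, remove
-- them with y_k = u.  Otherwise u has degree at most k − 1, so y₁ = w, y_k = u
-- works, the rest being filled up by vertices of degree at most 1.  If there is no
-- such u, an isolated vertex serves as y₁ and the rest is filled up likewise.
module Submission where

open import Defs
open import Data.Bool using (true; false; T; T?)
open import Data.Fin using (Fin; toℕ; inject₁; fromℕ) renaming (zero to fzero; suc to fsuc)
import Data.Fin.Properties as Fin
open import Data.Fin.Relation.Unary.Top using (view; ‵fromℕ; ‵inject₁)
open import Data.List using (List; []; _∷_; _++_; length; filter; map; foldr; take; lookup; allFin)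
open import Data.List.Membership.Propositional using (_∈_; _∉_; find; lose)
open import Data.List.Membership.Propositional.Properties
  using (∈-filter⁻; ∈-filter⁺; ∈-++⁺ˡ; ∈-++⁺ʳ; ∈-++⁻; ∈-∃++; ∈-map⁺; ∈-allFin)
open import Data.List.Properties
  using (length-++; length-take; length-map; length-tabulate; ++-identityʳ; filter-++;
         filter-all; filter-none; filter-some; filter-accept; filter-reject; filter-≐)
open import Data.List.Relation.Binary.Permutation.Propositional
open import Data.List.Relation.Binary.Permutation.Propositional.Properties
  using (shift; ↭-length; filter-↭; ∈-resp-↭; ++-assoc)
import Data.List.Relation.Binary.Permutation.Setoid.Properties as SetoidPerm
open import Data.List.Relation.Unary.All as All using (All; []; _∷_)
import Data.List.Relation.Unary.All.Properties as All
open import Data.List.Relation.Unary.AllPairs using ([]; _∷_)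
open import Data.List.Relation.Unary.Any as Any using (here; there)
open import Data.List.Relation.Unary.Any.Properties using (lookup-index)
open import Data.List.Relation.Unary.Unique.Propositional using (Unique)
import Data.List.Relation.Unary.Unique.Propositional.Properties as Unique
open import Data.Nat using (ℕ; zero; suc; _+_; _≤_; _<_; z≤n; s≤s; _≡ᵇ_; _⊔_; _/_; ⌈_/2⌉; ⌊_/2⌋)
open import Data.Nat.Divisibility using (∣-refl)
open import Data.Nat.DivMod using (+-distrib-/-∣ˡ; n/n≡1; /-monoˡ-≤)
open import Data.Nat.Properties
open import Data.List.Membership.DecPropositional _≟_ using (_∈?_)
open import Data.Product using (Σ; ∃; ∃₂; _×_; _,_; proj₁; proj₂)
open import Data.Sum using (_⊎_; inj₁; inj₂)
open import Function using (_∘_; Injective)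
open import Level using (0ℓ)
open import Relation.Binary using (Rel; Decidable; Symmetric; Irreflexive; tri<; tri≈; tri>)
open import Relation.Binary.PropositionalEquality as ≡
  using (_≡_; _≢_; sym; cong; cong₂; subst; subst₂)
open import Relation.Nullary using (¬_; Dec; yes; no; contradiction; ¬?; _×-dec_; _⊎-dec_)
open import Relation.Nullary.Decidable using (decidable-stable)
import Relation.Unary as Unary

-- Cycles, and cycles obtained from walks.

cycle-two-neighbours : ∀ {n} {E : Rel (Fin n) 0ℓ} → Symmetric E →
  ((m , f , _) : HasCycle E) → ∀ i →
  ∃₂ λ j j′ → f j ≢ f j′ × E (f i) (f j) × E (f i) (f j′)
cycle-two-neighbours E-sym (m , f , inj , steps , close) fzero =
  fsuc fzero , fromℕ (2 + m) , (λ eq → contradiction (inj eq) λ ())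
  , steps fzero , E-sym close
cycle-two-neighbours {E = E} E-sym (m , f , inj , steps , close) (fsuc i) =
  inject₁ i , proj₁ next , proj₁ (proj₂ next)
  , E-sym (steps i) , proj₂ (proj₂ next)
  where
  next : ∃ λ j → f (inject₁ i) ≢ f j × E (f (fsuc i)) (f j)
  -- The cyclic successor: after the last vertex comes the first. It differs from the predecessor
  -- because a cycle has at least three vertices.
  next with view i
  ... | ‵fromℕ     = fzero , (λ eq → contradiction (inj eq) λ ()) , close
  ... | ‵inject₁ j = fsuc (fsuc j) , distinct , steps (fsuc j)
    where
    distinct : f (inject₁ (inject₁ j)) ≢ f (fsuc (fsuc j))
    distinct eq = m≢1+n+m (toℕ j) {1}
      (≡.trans (sym (≡.trans (Fin.toℕ-inject₁ (inject₁ j)) (Fin.toℕ-inject₁ j))) (cong toℕ (inj eq)))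

acyclic-mono : ∀ {n} (E F : Rel (Fin n) 0ℓ) → (∀ {u v} → E u v → F u v) →
  Acyclic F → Acyclic E
acyclic-mono E F E⊆F acyclic (m , f , inj , steps , close) =
  acyclic (m , f , inj , E⊆F ∘ steps , E⊆F close)

module _ {n : ℕ} (w : ℕ → Fin n) where

  InjectiveBelow : ℕ → Set
  InjectiveBelow N = ∀ {i j} → i < j → j < N → w i ≢ w j

  -- Injectivity below `j` makes this the first return of the walk, so the stretch from `i` up to
  -- `j` is a path.
  FirstRepetition : Set
  FirstRepetition = ∃₂ λ i j → i < j × w i ≡ w j × InjectiveBelow j

  injective-below? : ∀ N → InjectiveBelow N ⊎ FirstRepetition
  injective-below? zero = inj₁ λ _ ()
  injective-below? (suc N) with injective-below? N
  ... | inj₂ repetition = inj₂ repetition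
  ... | inj₁ inj with anyUpTo? (λ i → w i Fin.≟ w N) N
  ...   | yes (i , i<N , eq) = inj₂ (i , N , i<N , eq , inj)
  ...   | no none = inj₁ extended
    where
    extended : InjectiveBelow (suc N)
    extended i<j (s≤s j≤N) eq with m≤n⇒m<n∨m≡n j≤N
    ... | inj₁ j<N  = inj i<j j<N eq
    ... | inj₂ ≡.refl = none (_ , i<j , eq)

  first-repetition : FirstRepetition
  first-repetition with injective-below? (suc n)
  ... | inj₂ repetition = repetition
  ... | inj₁ inj with Fin.pigeonhole (n<1+n n) (w ∘ toℕ)
  ...   | i , j , i<j , eq = contradiction eq (inj i<j (Fin.toℕ<n j))

  module _ {E : Rel (Fin n) 0ℓ} (E-irrefl : Irreflexive _≡_ E)
           (steps : ∀ i → E (w i) (w (suc i)))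
           (no-return : ∀ i → w (2 + i) ≢ w i) where

    -- The first return closes a cycle: length 1 is excluded by irreflexivity and length 2 by
    -- `no-return`, so at least three distinct vertices remain.
    nonbacktracking⇒cycle : HasCycle E
    nonbacktracking⇒cycle with first-repetition
    ... | i , j , i<j , eq , inj with m≤n⇒∃[o]m+o≡n i<j
    ...   | zero , ≡.refl = contradiction (steps i)
                            (E-irrefl (≡.trans eq (cong (w ∘ suc) (+-identityʳ i))))
    ...   | suc zero , ≡.refl = contradiction
                            (sym (≡.trans eq (cong (w ∘ suc) (+-comm i 1)))) (no-return i)
    ...   | suc (suc m) , ≡.refl = m , f , f-inj , f-steps , f-close
      where
      f : Fin (3 + m) → Fin n
      f t = w (i + toℕ t)
      top : suc (i + (2 + m)) ≡ i + (3 + m)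
      top = sym (+-suc i (2 + m))
      bound : ∀ t → i + toℕ t < suc (i + (2 + m))
      bound t = subst (i + toℕ t <_) (sym top) (+-monoʳ-< i (Fin.toℕ<n t))
      f-inj : ∀ {s t} → f s ≡ f t → s ≡ t
      f-inj {s} {t} fs≡ft with <-cmp (toℕ s) (toℕ t)
      ... | tri< s<t _ _ = contradiction fs≡ft (inj (+-monoʳ-< i s<t) (bound t))
      ... | tri≈ _ s≡t _ = Fin.toℕ-injective s≡t
      ... | tri> _ _ t<s = contradiction (sym fs≡ft) (inj (+-monoʳ-< i t<s) (bound s))
      f-steps : ∀ t → E (f (inject₁ t)) (f (fsuc t))
      f-steps t = subst₂ (λ a b → E (w a) (w b))
        (cong (i +_) (sym (Fin.toℕ-inject₁ t))) (sym (+-suc i (toℕ t))) (steps (i + toℕ t))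
      f-close : E (f (fromℕ (2 + m))) (f fzero)
      f-close = subst₂ E (cong (λ d → w (i + d)) (sym (Fin.toℕ-fromℕ (2 + m))))
        (≡.trans (sym eq) (cong w (sym (+-identityʳ i)))) (steps (i + (2 + m)))

-- Forests have vertices of degree at most 1.

another-element : ∀ {A : Set} {xs : List A} → Unique xs → 2 ≤ length xs →
  (_≟_ : Decidable {A = A} _≡_) → ∀ p → ∃ λ x → x ∈ xs × x ≢ p
another-element {xs = x ∷ y ∷ _} ((x≢y ∷ _) ∷ _) _ _≟_ p with x ≟ p
... | no x≢p   = x , here ≡.refl , x≢p
... | yes ≡.refl = y , there (here ≡.refl) , x≢y ∘ sym
another-element {xs = _ ∷ []} _ (s≤s ())

module _ {n : ℕ} {E : Rel (Fin n) 0ℓ} (E? : Decidable E) where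

  deg : List (Fin n) → Fin n → ℕ
  deg R u = length (filter (E? u) R)

  -- This is 1-degeneracy, with vertex sets as duplicate-free lists and `r` as a witness of
  -- non-emptiness. The colouring argument uses the acyclicity of A only in this form.
  Degenerate : Set
  Degenerate = ∀ {R r} → Unique R → r ∈ R → ∃ λ u → u ∈ R × deg R u ≤ 1

  -- If every vertex of `R` had two neighbours in `R`, a walk could always go on to a neighbour
  -- other than the one it came from, and would run into a cycle.
  acyclic⇒degenerate : Irreflexive _≡_ E → Acyclic E → Degenerate
  acyclic⇒degenerate E-irrefl acyclic {R} {r} R! r∈R with All.all? (λ u → 2 ≤? deg R u) R
  ... | no ¬all = u , u∈R , ≤-pred (≰⇒> small)
    where
    exceptional = find (All.¬All⇒Any¬ (λ u → 2 ≤? deg R u) R ¬all)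
    u = proj₁ exceptional
    u∈R = proj₁ (proj₂ exceptional)
    small = proj₂ (proj₂ exceptional)
  ... | yes all = contradiction
          (nonbacktracking⇒cycle (proj₁ ∘ proj₂ ∘ walk) E-irrefl
            (λ i → proj₁ (proj₂ (proj₂ (onward (walk i)))))
            (λ i → proj₂ (proj₂ (proj₂ (onward (walk (suc i)))))))
          acyclic
    where
    -- the previous and the current vertex of a walk in R
    State : Set
    State = Fin n × Σ (Fin n) (_∈ R)

    onward : ((p , u , _) : State) → ∃ λ v → v ∈ R × E u v × v ≢ p
    onward (p , u , u∈R) with another-element (Unique.filter⁺ (E? u) R!) (All.lookup all u∈R) Fin._≟_ p
    ... | v , v∈ , v≢p with ∈-filter⁻ (E? u) v∈
    ...   | v∈R , Euv = v , v∈R , Euv , v≢p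

    advance : State → State
    advance s@(_ , u , _) = u , proj₁ (onward s) , proj₁ (proj₂ (onward s))

    walk : ℕ → State
    -- The start has no predecessor; `r` itself is a harmless stand-in.
    walk zero = r , r , r∈R
    walk (suc i) = advance (walk i)

-- Duplicate-free lists as sets, and the pigeonhole principle.

Unique-resp-↭ : ∀ {A : Set} {xs ys : List A} → xs ↭ ys → Unique xs → Unique ys
Unique-resp-↭ p = SetoidPerm.Unique-resp-↭ (≡.setoid _) (↭⇒↭ₛ p)

∈⇒↭ : ∀ {A : Set} {x : A} {xs} → x ∈ xs → ∃ λ ys → xs ↭ x ∷ ys
∈⇒↭ x∈xs with ∈-∃++ x∈xs
... | ys , zs , ≡.refl = ys ++ zs , shift _ ys zs

-- Turns an inclusion of sets into a splitting of lists, which serves both to remove a block of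
-- vertices and to compare lengths.
⊆⇒↭ : ∀ {A : Set} {xs ys : List A} → Unique xs → (∀ {x} → x ∈ xs → x ∈ ys) →
  ∃ λ zs → ys ↭ xs ++ zs
⊆⇒↭ {xs = []}     _               _     = _ , refl
⊆⇒↭ {xs = x ∷ xs} (x∉xs ∷ xs!) xs⊆ys with ∈⇒↭ (xs⊆ys (here ≡.refl))
... | ys′ , ys↭ with ⊆⇒↭ xs! (λ y∈xs →
       Any.tail (All.lookup x∉xs y∈xs ∘ sym) (∈-resp-↭ ys↭ (xs⊆ys (there y∈xs))))
...   | zs , ys′↭ = zs , trans ys↭ (prep x ys′↭)

Unique-++⁻ʳ : ∀ {A : Set} (xs : List A) {ys} → Unique (xs ++ ys) → Unique ys
Unique-++⁻ʳ []       ys!       = ys!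
Unique-++⁻ʳ (_ ∷ xs) (_ ∷ xys!) = Unique-++⁻ʳ xs xys!

filter-split : ∀ {A : Set} {P : Unary.Pred A 0ℓ} (P? : Unary.Decidable P) xs →
  xs ↭ filter P? xs ++ filter (¬? ∘ P?) xs
filter-split P? [] = refl
filter-split P? (x ∷ xs) with P? x
... | yes _ = prep x (filter-split P? xs)
... | no  _ = trans (prep x (filter-split P? xs)) (↭-sym (shift x (filter P? xs) _))

-- Otherwise two indices would have their values at the same position of `xs`, against injectivity.
-- This provides the free colour in the greedy step.
injection-avoids : ∀ {k} (f : Fin k → ℕ) → Injective _≡_ _≡_ f →
  ∀ xs → length xs < k → ∃ λ i → f i ∉ xs
injection-avoids f f-inj xs xs<k with Fin.any? (λ i → ¬? (f i ∈? xs))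
... | yes avoided = avoided
... | no none with Fin.pigeonhole xs<k (Any.index ∘ covered)
  where
  covered : ∀ i → f i ∈ xs
  covered i = decidable-stable (f i ∈? xs) λ fi∉xs → none (i , fi∉xs)
...   | i , j , i<j , eq = contradiction (f-inj fi≡fj) (Fin.<⇒≢ i<j)
  where
  fi≡fj : f i ≡ f j
  fi≡fj = ≡.trans (lookup-index (decidable-stable (f i ∈? xs) _))
    (≡.trans (cong (lookup xs) eq) (sym (lookup-index (decidable-stable (f j ∈? xs) _))))

-- Sizes of colour classes and the bound on them.

module Counting {n : ℕ} where

  count : (Fin n → ℕ) → ℕ → List (Fin n) → ℕ
  count c x R = length (filter (λ v → c v ≟ x) R)

  count-cong : ∀ {c c′ : Fin n → ℕ} x R → (∀ {v} → v ∈ R → c v ≡ c′ v) →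
    count c x R ≡ count c′ x R
  count-cong x [] _ = ≡.refl
  count-cong {c} {c′} x (v ∷ R) same rewrite same (here ≡.refl) with c′ v ≡ᵇ x
  ... | true  = cong suc (count-cong x R (same ∘ there))
  ... | false = count-cong x R (same ∘ there)

  count-++ : ∀ c x S R → count c x (S ++ R) ≡ count c x S + count c x R
  count-++ c x S R = ≡.trans (cong length (filter-++ (λ v → c v ≟ x) S R)) (length-++ (filter (λ v → c v ≟ x) S))

  count-↭ : ∀ c x {R S} → R ↭ S → count c x R ≡ count c x S
  count-↭ c x p = ↭-length (filter-↭ (λ v → c v ≟ x) p)

-- Removing `suc k` vertices lowers the bound by exactly one, which pays for the at most one vertex
-- of each colour in a block.
ceilDiv-+ : ∀ k r → ceilDiv (suc k + r) (suc k) ≡ suc (ceilDiv r (suc k))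
ceilDiv-+ k r = ≡.trans (cong (_/ suc k) (+-assoc (suc k) r k))
  (≡.trans (+-distrib-/-∣ˡ {suc k} (r + k) ∣-refl) (cong (_+ (r + k) / suc k) (n/n≡1 (suc k))))

ceilDiv-pos : ∀ k r → 1 ≤ ceilDiv (suc r) (suc k)
ceilDiv-pos k r = ≤-trans (≤-reflexive (sym (n/n≡1 (suc k)))) (/-monoˡ-≤ (suc k) (s≤s (m≤n+m k r)))

-- Degrees within vertex lists, and removable blocks.

module Degrees {n : ℕ} {E : Rel (Fin n) 0ℓ} (E? : Decidable E) where

  private
    d : List (Fin n) → Fin n → ℕ
    d = deg E?

  deg-++ : ∀ S R u → d (S ++ R) u ≡ d S u + d R u
  deg-++ S R u = ≡.trans (cong length (filter-++ (E? u) S R)) (length-++ (filter (E? u) S))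

  deg-split : ∀ {R} S {R′} → R ↭ S ++ R′ → ∀ u → d R u ≡ d S u + d R′ u
  deg-split S {R′} p u = ≡.trans (↭-length (filter-↭ (E? u) p)) (deg-++ S R′ u)

  deg-mono : ∀ {R} S {R′} → R ↭ S ++ R′ → ∀ u → d R′ u ≤ d R u
  deg-mono S p u = ≤-trans (m≤n+m _ (d S u)) (≤-reflexive (sym (deg-split S p u)))

  deg-pos : ∀ {R u v} → v ∈ R → E u v → 1 ≤ d R u
  deg-pos {u = u} v∈R Euv = filter-some (E? u) (lose v∈R Euv)

  neighbour : ∀ {R u} → 1 ≤ d R u → ∃ λ v → v ∈ R × E u v
  neighbour {R} {u} pos with filter (E? u) R in eq
  ... | v ∷ _ = v , ∈-filter⁻ (E? u) (subst (v ∈_) (sym eq) (here ≡.refl))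

  -- The only neighbour of `w` goes away with `S`.
  sole-neighbour : ∀ {R S R′ u w} → R ↭ S ++ R′ → u ∈ S → E w u → d R w ≤ 1 → d R′ w ≡ 0
  sole-neighbour {R} {S} {R′} {u} {w} p u∈S Ewu leaf = n≤0⇒n≡0 (≤-pred (begin
    1 + d R′ w     ≤⟨ +-monoˡ-≤ (d R′ w) (deg-pos u∈S Ewu) ⟩
    d S w + d R′ w ≡⟨ deg-split S p w ⟨
    d R w          ≤⟨ leaf ⟩
    1              ∎))
    where open ≤-Reasoning

  -- S is coloured from right to left, after R: a vertex must then avoid the
  -- colours of its neighbours in R and those of the suffix of S behind it.
  data Fits (k : ℕ) (R : List (Fin n)) : List (Fin n) → Set where
    []  : Fits k R []
    _∷_ : ∀ {y S} → d R y + length S < k → Fits k R S → Fits k R (y ∷ S)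

  -- What one induction step removes. With `S` listed as y₁, ..., y_k, `Fits` says that y_i has less
  -- than i neighbours in `R′`.
  Block : ℕ → List (Fin n) → Set
  Block k R = ∃₂ λ S R′ → R ↭ S ++ R′ × length S ≡ k × Fits k R′ S

  -- The first vertex of `M` is the worst case, since the later ones have fewer colours behind them.
  -- The numerical condition says that at least `b` places stay free in front of `M`.
  fits-++ : ∀ {k R} b {M T} → All (λ y → d R y ≤ b) M → b + (length M + length T) ≤ k →
    Fits k R T → Fits k R (M ++ T)
  fits-++ b [] _ fits = fits
  fits-++ {k} {R} b {y ∷ M} {T} (y≤b ∷ M≤b) bound fits = (begin-strict
    d R y + length (M ++ T)       ≤⟨ +-monoˡ-≤ _ y≤b ⟩
    b + length (M ++ T)           ≡⟨ cong (b +_) (length-++ M) ⟩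
    b + (length M + length T)     <⟨ +-monoʳ-< b (n<1+n _) ⟩
    b + suc (length M + length T) ≤⟨ bound ⟩
    k                             ∎)
    ∷ fits-++ b M≤b (≤-trans (+-monoʳ-≤ b (n≤1+n _)) bound) fits
    where open ≤-Reasoning

  -- Isolated vertices count as leaves too, so that non-leaves have degree at least 2.
  leaf? : ∀ R y → Dec (d R y ≤ 1)
  leaf? R y = d R y ≤? 1

  leaves nonleaves : List (Fin n) → List (Fin n)
  leaves R = filter (leaf? R) R
  nonleaves R = filter (¬? ∘ leaf? R) R

  module _ (E-sym : Symmetric E) (degenerate : Degenerate E?) where

    -- Vertices of degree at most 1 in the current remainder are taken out one by one. Later
    -- removals only lower degrees, so the bounds hold for the final `R′`. Such vertices fill up
    -- blocks.
    extract-degenerate : ∀ m {R} → Unique R → m ≤ length R →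
      ∃₂ λ M R′ → R ↭ M ++ R′ × length M ≡ m × All (λ y → d R′ y ≤ 1) M
    extract-degenerate zero _ _ = [] , _ , refl , ≡.refl , []
    extract-degenerate (suc m) {R@(_ ∷ _)} R! m<R with degenerate R! (here ≡.refl)
    ... | u , u∈R , small with ∈⇒↭ u∈R
    ...   | R₁ , R↭ with Unique-resp-↭ R↭ R!
    ...     | _ ∷ R₁! with extract-degenerate m R₁! (≤-pred (≤-trans m<R (≤-reflexive (↭-length R↭))))
    ...       | M , R′ , R₁↭ , lenM , M≤1 = u ∷ M , R′ , R↭′ , cong suc lenM
                    , ≤-trans (deg-mono (u ∷ M) R↭′ u) small ∷ M≤1
      where R↭′ = trans R↭ (prep u R₁↭)

    -- Deleting the leaves leaves a forest, in which some `u` has degree at most 1. If nothing is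
    -- left, all degrees are at most 1, and `r` is isolated or is itself the leaf `w`.
    isolated-or-penultimate : ∀ {R r} → Unique R → r ∈ R →
      (∃ λ w → w ∈ R × d R w ≡ 0) ⊎
      (∃₂ λ u w → u ∈ R × w ∈ R × E u w × d R w ≤ 1 × d (nonleaves R) u ≤ 1)
    isolated-or-penultimate {R} {r} R! r∈R with nonleaves R in eq
    -- A non-leaf with at most one non-leaf neighbour must have a leaf neighbour.
    ... | N@(x ∷ _) with degenerate (subst Unique eq (Unique.filter⁺ (¬? ∘ leaf? R) R!)) (here ≡.refl)
    ...   | u , u∈N , small with ∈-filter⁻ (¬? ∘ leaf? R) {xs = R} (subst (u ∈_) (sym eq) u∈N)
    ...     | u∈R , nonleaf with neighbour {leaves R} {u} (+-cancelʳ-≤ 1 _ _ (begin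
      2                                  ≤⟨ ≰⇒> nonleaf ⟩
      d R u                              ≡⟨ deg-split (leaves R) (filter-split (leaf? R) R) u ⟩
      d (leaves R) u + d (nonleaves R) u ≡⟨ cong (λ N → d (leaves R) u + d N u) eq ⟩
      d (leaves R) u + d N u             ≤⟨ +-monoʳ-≤ (d (leaves R) u) small ⟩
      d (leaves R) u + 1                 ∎))
      where open ≤-Reasoning
    ...       | w , w∈ , Euw with ∈-filter⁻ (leaf? R) {xs = R} w∈
    ...         | w∈R , leaf = inj₂ (u , w , u∈R , w∈R , Euw , leaf , small)
    isolated-or-penultimate {R} {r} R! r∈R | [] with d R r in deg≡
    ... | zero = inj₁ (r , r∈R , deg≡)
    ... | suc _ with neighbour {R} {r} (subst (1 ≤_) (sym deg≡) (s≤s z≤n))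
    ...   | u , u∈R , Eru = inj₂ (u , r , u∈R , r∈R , E-sym Eru , r-leaf , z≤n)
      where
      r-leaf : d R r ≤ 1
      r-leaf with d R r ≤? 1
      ... | yes leaf = leaf
      ... | no nonleaf with subst (r ∈_) eq (∈-filter⁺ (¬? ∘ leaf? R) r∈R nonleaf)
      ...   | ()

    -- Only the first place demands a vertex without outside neighbours, and `w` takes it; all later
    -- places tolerate one outside neighbour.
    isolated-block : ∀ k {R w} → Unique R → k < length R → w ∈ R → d R w ≡ 0 → Block (suc k) R
    isolated-block k {R} {w} R! k<R w∈R isolated with ∈⇒↭ w∈R
    ... | R₁ , R↭ with Unique-resp-↭ R↭ R!
    ...   | _ ∷ R₁! with extract-degenerate k R₁! (≤-pred (≤-trans k<R (≤-reflexive (↭-length R↭))))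
    ...     | M , R′ , R₁↭ , lenM , M≤1 = w ∷ M , R′ , R↭′ , cong suc lenM , w-fits ∷ M-fits
      where
      R↭′ : R ↭ w ∷ M ++ R′
      R↭′ = trans R↭ (prep w R₁↭)
      w-fits : d R′ w + length M < suc k
      w-fits = s≤s (+-mono-≤ (≤-trans (deg-mono (w ∷ M) R↭′ w) (≤-reflexive isolated)) (≤-reflexive lenM))
      M-fits : Fits (suc k) R′ M
      M-fits = subst (Fits (suc k) R′) (++-identityʳ M)
        (fits-++ 1 M≤1 (s≤s (≤-reflexive (≡.trans (+-identityʳ _) lenM))) [])

    -- With `u` in the block its leaf neighbours have no neighbours outside and fit anywhere. The
    -- last place allows `u` up to `k` outside neighbours, and `k` of its at most 2k neighbours are
    -- in the block. The degree bound is used only here.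
    all-leaves-block : Irreflexive _≡_ E → ∀ k {R u} → Unique R → u ∈ R → d R u ≤ k + k →
      k ≤ d (leaves R) u → Block (suc k) R
    all-leaves-block E-irrefl k {R} {u} R! u∈R d≤ many =
      S , R′ , R↭ , lenS , fits-++ 0 M-leaves (≤-reflexive lenS′) (u-fits ∷ [])
      where
      ls = filter (E? u) (leaves R)
      M = take k ls
      S = M ++ u ∷ []
      lenM : length M ≡ k
      lenM = ≡.trans (length-take k ls) (m≤n⇒m⊓n≡m many)
      lenS′ : length M + 1 ≡ suc k
      lenS′ = ≡.trans (cong (_+ 1) lenM) (+-comm k 1)
      lenS : length S ≡ suc k
      lenS = ≡.trans (length-++ M) lenS′
      M-all : All (λ y → y ∈ R × d R y ≤ 1 × E u y) M
      M-all = All.take⁺ k (All.tabulate λ y∈ls →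
        let y∈leaves , Euy = ∈-filter⁻ (E? u) {xs = leaves R} y∈ls
            y∈R , leaf = ∈-filter⁻ (leaf? R) {xs = R} y∈leaves
        in y∈R , leaf , Euy)
      S! : Unique S
      S! = Unique.++⁺ (Unique.take⁺ k (Unique.filter⁺ (E? u) (Unique.filter⁺ (leaf? R) R!))) ([] ∷ [])
        λ where (y∈M , here y≡u) → E-irrefl (sym y≡u) (proj₂ (proj₂ (All.lookup M-all y∈M)))
      S⊆R : ∀ {x} → x ∈ S → x ∈ R
      S⊆R x∈S with ∈-++⁻ M x∈S
      ... | inj₁ x∈M           = proj₁ (All.lookup M-all x∈M)
      ... | inj₂ (here ≡.refl) = u∈R
      R′ = proj₁ (⊆⇒↭ S! S⊆R)
      R↭ : R ↭ S ++ R′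
      R↭ = proj₂ (⊆⇒↭ S! S⊆R)
      M-leaves : All (λ y → d R′ y ≤ 0) M
      M-leaves = All.map (λ (_ , leaf , Euy) →
        ≤-reflexive (sole-neighbour R↭ (∈-++⁺ʳ M (here ≡.refl)) (E-sym Euy) leaf)) M-all
      k≤dS : k ≤ d S u
      k≤dS = begin
        k                    ≡⟨ lenM ⟨
        length M             ≡⟨ cong length (filter-all (E? u) (All.map (λ (_ , _ , Euy) → Euy) M-all)) ⟨
        d M u                ≤⟨ m≤m+n (d M u) _ ⟩
        d M u + d (u ∷ []) u ≡⟨ deg-++ M _ u ⟨
        d S u                ∎
        where open ≤-Reasoning
      u-fits : d R′ u + 0 < suc k
      u-fits = s≤s (+-cancelˡ-≤ k _ _ (begin
        k + (d R′ u + 0) ≡⟨ cong (k +_) (+-identityʳ _) ⟩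
        k + d R′ u       ≤⟨ +-monoˡ-≤ (d R′ u) k≤dS ⟩
        d S u + d R′ u   ≡⟨ deg-split S R↭ u ⟨
        d R u            ≤⟨ d≤ ⟩
        k + k            ∎))
        where open ≤-Reasoning

    -- The leaf `w` can come first because its sole neighbour `u` is in the block, and the last
    -- place allows `u` all of its at most `suc k` neighbours.
    leaf-block : Irreflexive _≡_ E → ∀ k {R u w} → Unique R → 2 + k ≤ length R → u ∈ R → w ∈ R →
      E u w → d R w ≤ 1 → d R u ≤ suc k → Block (2 + k) R
    leaf-block E-irrefl k {R} {u} {w} R! k<R u∈R w∈R Euw leaf small
      with ⊆⇒↭ {xs = u ∷ w ∷ []} (((λ u≡w → E-irrefl u≡w Euw) ∷ []) ∷ [] ∷ [])
             (λ where (here ≡.refl) → u∈R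
                      (there (here ≡.refl)) → w∈R)
    ... | R₁ , R↭ with Unique-resp-↭ R↭ R!
    ...   | _ ∷ _ ∷ R₁!
      with extract-degenerate k R₁! (≤-pred (≤-pred (≤-trans k<R (≤-reflexive (↭-length R↭)))))
    ...     | M , R′ , R₁↭ , lenM , M≤1 =
        S , R′ , R↭S , lenS , w-fits ∷ fits-++ 1 M≤1 (s≤s (≤-reflexive lenM1)) (u-fits ∷ [])
      where
      S = w ∷ M ++ u ∷ []
      lenM1 : length M + 1 ≡ suc k
      lenM1 = ≡.trans (cong (_+ 1) lenM) (+-comm k 1)
      lenS : length S ≡ 2 + k
      lenS = cong suc (≡.trans (length-++ M) lenM1)
      R↭S : R ↭ S ++ R′
      R↭S = begin
        R                        ↭⟨ R↭ ⟩
        u ∷ w ∷ R₁               ↭⟨ prep u (prep w R₁↭) ⟩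
        u ∷ w ∷ M ++ R′          ↭⟨ shift u (w ∷ M) R′ ⟨
        (w ∷ M) ++ u ∷ R′        ↭⟨ ++-assoc (w ∷ M) (u ∷ []) R′ ⟨
        (w ∷ M ++ u ∷ []) ++ R′  ∎
        where open PermutationReasoning
      w-fits : d R′ w + length (M ++ u ∷ []) < 2 + k
      w-fits = s≤s (≤-reflexive (cong₂ _+_
        (sole-neighbour R↭S (there (∈-++⁺ʳ M (here ≡.refl))) (E-sym Euw) leaf)
        (≡.trans (length-++ M) lenM1)))
      u-fits : d R′ u + 0 < 2 + k
      u-fits = s≤s (≤-trans (≤-reflexive (+-identityʳ _)) (≤-trans (deg-mono S R↭S u) small))

    block : Irreflexive _≡_ E → ∀ k {R} → Unique R → k < length R → (∀ u → d R u ≤ k + k) → Block (suc k) R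
    block E-irrefl k {R@(_ ∷ _)} R! k<R d≤ with isolated-or-penultimate R! (here ≡.refl)
    ... | inj₁ (w , w∈R , isolated) = isolated-block k R! k<R w∈R isolated
    ... | inj₂ (u , w , u∈R , w∈R , Euw , leaf , small) with k ≤? d (leaves R) u
    ...   | yes many = all-leaves-block E-irrefl k R! u∈R (d≤ u) many
    ...   | no few = few-leaves k k<R few
      where
      -- Having fewer than `k` leaf neighbours forces `k` to be positive. Adding at most one
      -- non-leaf neighbour gives degree at most `k`.
      few-leaves : ∀ k → k < length R → ¬ k ≤ d (leaves R) u → Block (suc k) R
      few-leaves zero _ few = contradiction z≤n few
      few-leaves (suc k) k<R few = leaf-block E-irrefl k R! k<R u∈R w∈R Euw leaf (begin
        d R u                               ≡⟨ deg-split (leaves R) (filter-split (leaf? R) R) u ⟩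
        d (leaves R) u + d (nonleaves R) u  ≤⟨ +-mono-≤ (≤-pred (≰⇒> few)) small ⟩
        k + 1                               ≡⟨ +-comm k 1 ⟩
        suc k                               ∎)
        where open ≤-Reasoning

-- Greedy extension of a colouring to a block.

_[_↦_] : ∀ {n} → (Fin n → ℕ) → Fin n → ℕ → Fin n → ℕ
(c [ y ↦ x ]) v with v Fin.≟ y
... | yes _ = x
... | no _  = c v

update-same : ∀ {n} (c : Fin n → ℕ) y x → (c [ y ↦ x ]) y ≡ x
update-same c y x with y Fin.≟ y
... | yes _  = ≡.refl
... | no y≢y = contradiction ≡.refl y≢y

update-other : ∀ {n} (c : Fin n → ℕ) {y} x {v} → v ≢ y → (c [ y ↦ x ]) v ≡ c v
update-other c {y} x {v} v≢y with v Fin.≟ y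
... | yes v≡y = contradiction v≡y v≢y
... | no _    = ≡.refl

module Colouring {n k : ℕ} {E : Rel (Fin n) 0ℓ} (E? : Decidable E) (E-sym : Symmetric E)
  (E-irrefl : Irreflexive _≡_ E) (L : ListAssignment n k) (L-uniform : Uniform L) where

  open Counting {n}
  open Degrees E?

  FromLists Proper : (Fin n → ℕ) → List (Fin n) → Set
  FromLists c R = ∀ {v} → v ∈ R → ∃ λ i → L v i ≡ c v
  Proper c R = ∀ {u v} → u ∈ R → v ∈ R → E u v → c u ≢ c v

  -- The colour of `y` avoids those of its neighbours in `R` and of every vertex of `S` behind it;
  -- `Fits` leaves one free. Distinct colours on the block also make it properly coloured inside.
  extend : ∀ {R} c → FromLists c R → Proper c R → ∀ {S} → Fits k R S → Unique (S ++ R) →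
    ∃ λ c′ → (∀ {v} → v ∈ R → c′ v ≡ c v) × FromLists c′ (S ++ R) × Proper c′ (S ++ R)
           × (∀ x → count c′ x S ≤ 1)
  extend c list proper [] _ = c , (λ _ → ≡.refl) , list , proper , λ _ → z≤n
  extend {R} c list proper {y ∷ S} (fits ∷ fitsS) (y∉ ∷ SR!)
    with extend c list proper fitsS SR!
  ... | c₁ , agree , list₁ , proper₁ , rainbow
    with injection-avoids (L y) (L-uniform y) (map c₁ (filter (E? y) R ++ S))
           (subst (_< k) (sym (≡.trans (length-map c₁ (filter (E? y) R ++ S)) (length-++ (filter (E? y) R)))) fits)
  ... | i , new = c′ , (λ v∈R → ≡.trans (old (∈-++⁺ʳ S v∈R)) (agree v∈R)) , list′ , proper′ , rainbow′
    where
    x = L y i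
    c′ = c₁ [ y ↦ x ]

    here-new : c′ y ≡ x
    here-new = update-same c₁ y x

    old : ∀ {v} → v ∈ S ++ R → c′ v ≡ c₁ v
    old v∈ = update-other c₁ x λ v≡y → All.lookup y∉ v∈ (sym v≡y)

    list′ : FromLists c′ (y ∷ S ++ R)
    list′ (here ≡.refl) = i , sym here-new
    list′ (there v∈) with list₁ v∈
    ... | j , eq = j , ≡.trans eq (sym (old v∈))

    fresh : ∀ {v} → v ∈ S ++ R → E y v → x ≢ c₁ v
    fresh v∈ Eyv eq with ∈-++⁻ S v∈
    ... | inj₁ v∈S = new (subst (_∈ _) (sym eq) (∈-map⁺ c₁ (∈-++⁺ʳ (filter (E? y) R) v∈S)))
    ... | inj₂ v∈R = new (subst (_∈ _) (sym eq) (∈-map⁺ c₁ (∈-++⁺ˡ (∈-filter⁺ (E? y) v∈R Eyv))))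

    proper′ : Proper c′ (y ∷ S ++ R)
    proper′ (here ≡.refl) (here ≡.refl) Eyy _ = E-irrefl ≡.refl Eyy
    proper′ (here ≡.refl) (there v∈) Eyv eq = fresh v∈ Eyv (≡.trans (sym here-new) (≡.trans eq (old v∈)))
    proper′ (there u∈) (here ≡.refl) Euy eq = fresh u∈ (E-sym Euy) (≡.trans (sym here-new) (≡.trans (sym eq) (old u∈)))
    proper′ (there u∈) (there v∈) Euv eq = proper₁ u∈ v∈ Euv (≡.trans (sym (old u∈)) (≡.trans eq (old v∈)))

    rainbow′ : ∀ z → count c′ z (y ∷ S) ≤ 1
    rainbow′ z with c′ y ≟ z
    ... | no ≢z = subst (_≤ 1) (≡.trans (sym (count-cong z S (old ∘ ∈-++⁺ˡ)))
                    (cong length (sym (filter-reject (λ v → c′ v ≟ z) {y} {S} ≢z)))) (rainbow z)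
    ... | yes ≡.refl = ≤-reflexive (≡.trans
            (cong length (filter-accept (λ v → c′ v ≟ z) {y} {S} ≡.refl))
            (cong (suc ∘ length) (filter-none (λ v → c′ v ≟ z) (All.tabulate absent))))
      where
      absent : ∀ {v} → v ∈ S → c′ v ≢ c′ y
      absent v∈S eq = new (subst (_∈ _)
        (≡.trans (sym (old (∈-++⁺ˡ v∈S))) (≡.trans eq here-new))
        (∈-map⁺ c₁ (∈-++⁺ʳ (filter (E? y) R) v∈S)))

-- Equitable proper list colouring of a forest.

module _ {n k : ℕ} {E : Rel (Fin n) 0ℓ} (E? : Decidable E) (E-sym : Symmetric E)
  (E-irrefl : Irreflexive _≡_ E) (degenerate : Degenerate E?)
  (L : ListAssignment n (suc k)) (L-uniform : Uniform L) where

  open Counting {n}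
  open Degrees E?
  open Colouring E? E-sym E-irrefl L L-uniform

  -- Induction on the length bound `m`, as the remainder `R′` is not a structural part of `R`. Each
  -- block adds at most one vertex to a class while the bound rises by one.
  equitable-proper : ∀ m {R} → length R ≤ m → Unique R → (∀ {S} → Unique S → ∀ u → deg E? S u ≤ k + k) →
    ∃ λ c → FromLists c R × Proper c R × ∀ x → count c x R ≤ ceilDiv (length R) (suc k)
  equitable-proper m {[]} _ _ _ = (λ _ → 0) , (λ ()) , (λ ()) , λ _ → z≤n
  equitable-proper (suc m) {R@(_ ∷ R₀)} R≤m R! d≤ with suc k ≤? length R
  ... | yes k<R with block E-sym degenerate E-irrefl k R! k<R (d≤ R!)
  ...   | S , R′ , R↭ , lenS , fits
    with Unique-resp-↭ R↭ R!
  ...   | SR! with equitable-proper m {R′} R′≤m (Unique-++⁻ʳ S SR!) d≤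
    where
    lenR : length R ≡ suc k + length R′
    lenR = ≡.trans (↭-length R↭) (≡.trans (length-++ S) (cong (_+ length R′) lenS))
    R′≤m : length R′ ≤ m
    R′≤m = ≤-pred (≤-trans (s≤s (m≤n+m _ k)) (≤-trans (≤-reflexive (sym lenR)) R≤m))
  ...   | c , list , proper , sizes with extend c list proper fits SR!
  ...   | c′ , agree , list′ , proper′ , rainbow =
      c′ , list′ ∘ ∈-resp-↭ R↭ , (λ u∈ v∈ → proper′ (∈-resp-↭ R↭ u∈) (∈-resp-↭ R↭ v∈)) , sizes′
    where
    lenR : length R ≡ suc k + length R′
    lenR = ≡.trans (↭-length R↭) (≡.trans (length-++ S) (cong (_+ length R′) lenS))
    sizes′ : ∀ x → count c′ x R ≤ ceilDiv (length R) (suc k)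
    sizes′ x = begin
      count c′ x R                        ≡⟨ count-↭ c′ x R↭ ⟩
      count c′ x (S ++ R′)                ≡⟨ count-++ c′ x S R′ ⟩
      count c′ x S + count c′ x R′        ≡⟨ cong (count c′ x S +_) (count-cong x R′ agree) ⟩
      count c′ x S + count c x R′         ≤⟨ +-mono-≤ (rainbow x) (sizes x) ⟩
      suc (ceilDiv (length R′) (suc k))   ≡⟨ ceilDiv-+ k (length R′) ⟨
      ceilDiv (suc k + length R′) (suc k) ≡⟨ cong (λ r → ceilDiv r (suc k)) lenR ⟨
      ceilDiv (length R) (suc k)          ∎
      where open ≤-Reasoning
  -- Too few vertices for a block: all of them get distinct colours, extending the empty colouring.
  equitable-proper (suc m) {R@(_ ∷ R₀)} R≤m R! d≤ | no k≮R
    with extend {R = []} (λ _ → 0) (λ ()) (λ ())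
           (subst (Fits (suc k) []) (++-identityʳ R)
             (fits-++ 0 {R} (All.universal (λ _ → z≤n) R)
               (≤-trans (≤-reflexive (+-identityʳ _)) (≰⇒≥ k≮R)) []))
           (subst Unique (sym (++-identityʳ R)) R!)
  ... | c , _ , list , proper , rainbow =
    c , list ∘ ∈-++⁺ˡ , (λ u∈ v∈ → proper (∈-++⁺ˡ u∈) (∈-++⁺ˡ v∈))
    , λ x → ≤-trans (rainbow x) (ceilDiv-pos k (length R₀))

-- Splitting the graph into two forests and moving edges between them.

_∖_ : ∀ {n} → Graph n → Rel (Fin n) 0ℓ → Rel (Fin n) 0ℓ
(G ∖ B) u v = Adj G u v × ¬ B u v

-- The forest A is whatever B leaves of `G`, so enlarging B takes edges from A and keeps A acyclic.
record Split {n : ℕ} (G : Graph n) : Set₁ where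
  field
    B          : Rel (Fin n) 0ℓ
    B?         : Decidable B
    B-sym      : Symmetric B
    B⊆G        : ∀ {u v} → B u v → Adj G u v
    B-acyclic  : Acyclic B
    A-acyclic  : Acyclic (G ∖ B)

module _ {n : ℕ} (G : Graph n) where
  open Split

  Adj-sym : Symmetric (Adj G)
  Adj-sym {u} {v} = subst T (symm G u v)

  Adj-irrefl : Irreflexive _≡_ (Adj G)
  Adj-irrefl {u} ≡.refl = subst T (irrefl G u)

  decomposition⇒split : ForestDecomposition G 2 → Split G
  decomposition⇒split (c , c-sym , acyclic) = record
    { B = B₀
    ; B? = λ u v → T? (adj G u v) ×-dec (c u v Fin.≟ fzero)
    ; B-sym = λ {u} {v} (Guv , eq) → Adj-sym Guv , ≡.trans (sym (c-sym u v Guv)) eq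
    ; B⊆G = proj₁
    ; B-acyclic = acyclic fzero
    ; A-acyclic = acyclic-mono (G ∖ B₀) (λ u v → Adj G u v × c u v ≡ fsuc fzero)
        (λ (Guv , ¬B) → Guv , other _ (λ eq → ¬B (Guv , eq))) (acyclic (fsuc fzero))
    }
    where
    B₀ : Rel (Fin n) 0ℓ
    B₀ u v = Adj G u v × c u v ≡ fzero
    other : ∀ (j : Fin 2) → j ≢ fzero → j ≡ fsuc fzero
    other fzero ≢0 = contradiction ≡.refl ≢0
    other (fsuc fzero) _ = ≡.refl

  -- The neighbour `w` is a premise so that isolated vertices are covered vacuously.
  Covered : Split G → Fin n → Set
  Covered s v = ∀ {w} → Adj G v w → ∃ λ x → B s v x

  -- If `v` has an edge but none in B, adding one makes `v` a leaf of B and creates no cycle. B only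
  -- grows, so vertices covered before stay covered.
  cover : (s : Split G) → ∀ v → Σ (Split G) λ s′ →
    (∀ {x y} → B s x y → B s′ x y) × Covered s′ v
  cover s v with Fin.any? (B? s v) | Fin.any? (λ w → T? (adj G v w))
  ... | yes some | _ = s , (λ b → b) , λ _ → some
  ... | no _ | no isolated = s , (λ b → b) , λ Gvw → contradiction (_ , Gvw) isolated
  ... | no bare | yes (w , Gvw) = s′ , inj₁ , λ _ → w , inj₂ (inj₁ (≡.refl , ≡.refl))
    where
    B′ : Rel (Fin n) 0ℓ
    B′ x y = B s x y ⊎ (x ≡ v × y ≡ w) ⊎ (x ≡ w × y ≡ v)

    B′-sym : ∀ {x y} → B′ x y → B′ y x
    B′-sym (inj₁ b) = inj₁ (B-sym s b)
    B′-sym (inj₂ (inj₁ (p , q))) = inj₂ (inj₂ (q , p))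
    B′-sym (inj₂ (inj₂ (p , q))) = inj₂ (inj₁ (q , p))

    only-w : ∀ {x} → B′ v x → x ≡ w
    only-w (inj₁ b) = contradiction (_ , b) bare
    only-w (inj₂ (inj₁ (_ , x≡w))) = x≡w
    only-w (inj₂ (inj₂ (v≡w , _))) = contradiction Gvw (Adj-irrefl v≡w)

    old : ∀ {x y} → x ≢ v → y ≢ v → B′ x y → B s x y
    old _ _ (inj₁ b) = b
    old x≢v _ (inj₂ (inj₁ (x≡v , _))) = contradiction x≡v x≢v
    old _ y≢v (inj₂ (inj₂ (_ , y≡v))) = contradiction y≡v y≢v

    B′-acyclic : Acyclic B′
    -- A cycle through `v` would give it two neighbours in `B′`, where it has only `w`; any other
    -- cycle consists of old edges.
    B′-acyclic cycle@(m , f , inj , steps , close) with Fin.any? (λ i → f i Fin.≟ v)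
    ... | yes (i , ≡.refl) with cycle-two-neighbours (λ {x y} → B′-sym {x} {y}) cycle i
    ...   | j , j′ , distinct , b , b′ = distinct (≡.trans (only-w {f j} b) (sym (only-w {f j′} b′)))
    B′-acyclic cycle@(m , f , inj , steps , close) | no avoids =
      B-acyclic s (m , f , inj , (λ i → old (away _) (away _) (steps i)) , old (away _) (away _) close)
      where
      away : ∀ i → f i ≢ v
      away i eq = avoids (i , eq)

    s′ : Split G
    s′ = record
      { B = B′
      ; B? = λ x y → B? s x y ⊎-dec ((x Fin.≟ v ×-dec y Fin.≟ w) ⊎-dec (x Fin.≟ w ×-dec y Fin.≟ v))
      ; B-sym = B′-sym
      ; B⊆G = λ where
          (inj₁ b) → B⊆G s b
          (inj₂ (inj₁ (≡.refl , ≡.refl))) → Gvw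
          (inj₂ (inj₂ (≡.refl , ≡.refl))) → Adj-sym Gvw
      ; B-acyclic = B′-acyclic
      ; A-acyclic = acyclic-mono (G ∖ B′) (G ∖ B s) (λ (Gxy , ¬B′) → Gxy , ¬B′ ∘ inj₁) (A-acyclic s)
      }

  cover-all : Split G → ∀ vs → Σ (Split G) λ s → All (Covered s) vs
  cover-all s [] = s , []
  cover-all s (v ∷ vs) with cover-all s vs
  ... | s₁ , covered with cover s₁ v
  ...   | s₂ , B⊆ , covered-v = s₂ , covered-v ∷ All.map transfer covered
    where
    transfer : ∀ {u} → Covered s₁ u → Covered s₂ u
    transfer cov Guw with cov Guw
    ... | x , b = x , B⊆ b

  module _ (s : Split G) where

    A : Rel (Fin n) 0ℓ
    A = G ∖ B s

    A? : Decidable A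
    A? u v = T? (adj G u v) ×-dec ¬? (B? s u v)

    A-sym : Symmetric A
    A-sym (Guv , ¬B) = Adj-sym Guv , ¬B ∘ B-sym s

    A-irrefl : Irreflexive _≡_ A
    A-irrefl eq (Guv , _) = Adj-irrefl eq Guv

    -- An A-neighbour shows that `u` is not isolated, so `u` has a B-neighbour `x`. As `x` is not
    -- among the A-neighbours, it makes one more neighbour in `G`.
    deg-A≤ : ∀ {k R} → Unique R → ∀ u → Covered s u → degree G u ≤ suc k → deg A? R u ≤ k
    deg-A≤ {k} {R} R! u covered d≤ with filter (A? u) R in eq
    ... | [] = z≤n
    ... | N@(v ∷ _) with ∈-filter⁻ (A? u) {xs = R} (subst (v ∈_) (sym eq) (here ≡.refl))
    ...   | _ , Guv , _ with covered Guv
    ...     | x , Bux with ⊆⇒↭ {xs = x ∷ N} {filter (λ w → T? (adj G u w)) (allFin n)} (x∉N ∷ N!) ⊆neighbours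
      where
      N⊆A : ∀ {w} → w ∈ N → A u w
      N⊆A w∈N = proj₂ (∈-filter⁻ (A? u) {xs = R} (subst (_ ∈_) (sym eq) w∈N))
      N! : Unique N
      N! = subst Unique eq (Unique.filter⁺ (A? u) R!)
      x∉N : All (x ≢_) N
      x∉N = All.tabulate λ where w∈N ≡.refl → proj₂ (N⊆A w∈N) Bux
      ⊆neighbours : ∀ {w} → w ∈ x ∷ N → w ∈ filter (λ w → T? (adj G u w)) (allFin n)
      ⊆neighbours (here ≡.refl) = ∈-filter⁺ (λ w → T? (adj G u w)) (∈-allFin _) (B⊆G s Bux)
      ⊆neighbours (there w∈N) = ∈-filter⁺ (λ w → T? (adj G u w)) (∈-allFin _) (proj₁ (N⊆A w∈N))
    ...       | zs , p = ≤-pred (begin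
      suc (length N)              ≤⟨ s≤s (m≤m+n (length N) (length zs)) ⟩
      suc (length N + length zs)  ≡⟨ length-++ (x ∷ N) ⟨
      length (x ∷ N ++ zs)        ≡⟨ ↭-length p ⟨
      degree G u                  ≤⟨ d≤ ⟩
      suc k                       ∎)
      where open ≤-Reasoning

    -- An edge inside a class cannot lie in A, so the class induces a subgraph of the forest B.
    proper⇒classesAcyclic : ∀ c → (∀ {u v} → A u v → c u ≢ c v) → ClassesAcyclic G c
    proper⇒classesAcyclic c proper x = acyclic-mono _ (B s) class⊆B (B-acyclic s)
      where
      class⊆B : ∀ {u v} → Adj G u v × c u ≡ x × c v ≡ x → B s u v
      class⊆B {u} {v} (Guv , cu≡x , cv≡x) = decidable-stable (B? s u v)
        λ ¬B → proper (Guv , ¬B) (≡.trans cu≡x (sym cv≡x))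

  degree≤maxDegree : ∀ v → degree G v ≤ maxDegree G
  degree≤maxDegree v = go (allFin n) (∈-allFin v)
    where
    go : ∀ vs → v ∈ vs → degree G v ≤ foldr _⊔_ 0 (map (degree G) vs)
    go (_ ∷ vs) (here ≡.refl) = m≤m⊔n _ _
    go (x ∷ vs) (there v∈)    = ≤-trans (go vs v∈) (m≤n⊔m (degree G x) _)

-- The degree bound and the conclusion.

n≤2⌈n/2⌉ : ∀ n → n ≤ ⌈ n /2⌉ + ⌈ n /2⌉
n≤2⌈n/2⌉ n = begin
  n                   ≡⟨ ⌊n/2⌋+⌈n/2⌉≡n n ⟨
  ⌊ n /2⌋ + ⌈ n /2⌉   ≤⟨ +-monoˡ-≤ ⌈ n /2⌉ (⌊n/2⌋≤⌈n/2⌉ n) ⟩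
  ⌈ n /2⌉ + ⌈ n /2⌉   ∎
  where open ≤-Reasoning

theorem4 : ∀ (k : ℕ) {n : ℕ} (G : Graph n) → HasArboricity G 2 →
    ⌈ maxDegree G + 1 /2⌉ ≤ k → EquitablyListArborable G k
theorem4 k G _ Δ≤ _ _ with ≤-trans (n≤2⌈n/2⌉ (maxDegree G + 1)) (+-mono-≤ Δ≤ Δ≤)
-- Lists of size 0 are excluded, as Δ + 1 is positive; below, the lists have size `suc k`.
theorem4 zero G _ _ _ _ | Δ+1≤0 = contradiction (≤-trans (m≤n+m 1 (maxDegree G)) Δ+1≤0) λ ()
theorem4 (suc k) {n} G (decomposition , _) _ L L-uniform | Δ+1≤2k
  with cover-all G (decomposition⇒split G decomposition) (allFin n)
... | s , covered
  with equitable-proper (A? G s) (A-sym G s) (A-irrefl G s)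
         (acyclic⇒degenerate (A? G s) (A-irrefl G s) (Split.A-acyclic s)) L L-uniform
         (length (allFin n)) ≤-refl (Unique.allFin⁺ n)
         (λ S! u → deg-A≤ G s S! u (All.lookup covered (∈-allFin u)) (degree≤ u))
  where
  -- The edge that each non-isolated vertex has in B brings this down to 2k in A, as the blocks
  -- require.
  degree≤ : ∀ u → degree G u ≤ suc (k + k)
  degree≤ u = ≤-pred (begin
    suc (degree G u)  ≤⟨ s≤s (degree≤maxDegree G u) ⟩
    suc (maxDegree G) ≡⟨ +-comm 1 (maxDegree G) ⟩
    maxDegree G + 1   ≤⟨ Δ+1≤2k ⟩
    suc k + suc k     ≡⟨ cong suc (+-suc k k) ⟩
    suc (suc (k + k)) ∎)
    where open ≤-Reasoning
... | c , fromLists , proper , sizes =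
  c , (λ v → fromLists (∈-allFin v))
  , (λ x → subst (λ m → colourClassSize c x ≤ ceilDiv m (suc k)) (length-tabulate {n = n} (λ i → i))
      (≤-trans (≤-reflexive (classSize≡count x)) (sizes x)))
  , proper⇒classesAcyclic G s c (proper (∈-allFin _) (∈-allFin _))
  where
  -- The two counts differ only in testing colours by `≡ᵇ` or by `≟`.
  classSize≡count : ∀ x → colourClassSize c x ≡ Counting.count c x (allFin n)
  classSize≡count x = cong length (filter-≐ (λ v → T? (c v ≡ᵇ x)) (λ v → c v ≟ x)
    ((λ {v} → ≡ᵇ⇒≡ (c v) x) , (λ {v} → ≡⇒≡ᵇ (c v) x)) (allFin n))
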